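{- In any oriented graph, a vertex of maximum score is a weak king.
   Context: An oriented graph is a digraph with no loops and no pair of symmetric arcs. For vertices $u,v$ write $u(1\text{ - }0)v$ if there is an arc from $u$ to $v$, and $u(0\text{ - }0)v$ if there is no arc between $u$ and $v$. If $D$ has $n$ vertices, the score of a vertex $v$ is $s(v) = n-1+d^+(v)-d^-(v)$, where $d^+(v), d^-(v)$ are the out- and indegree of $v$. A vertex $v$ is weakly reachable within two steps from $u$ if $u(1\text{ - }0)v$, or $u(0\text{ - }0)v$, or for some vertex $w$ one has $u(1\text{ - }0)w(1\text{ - }0)v$, or $u(1\text{ - }0)w(0\text{ - }0)v$, or $u(0\text{ - }0)w(1\text{ - }0)v$. A vertex $u$ of $D$ is a weak king if every other vertex of $D$ is weakly reachable within two steps from $u$. -}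

module Defs where

open import Data.Fin.Base using (Fin)
open import Data.Integer.Base using (ℤ; +_; _+_; _-_; _≤_)
open import Data.List.Base using (length; filter; allFin)
open import Data.Nat.Base using (ℕ)
open import Data.Product.Base using (_×_; ∃-syntax)
open import Data.Sum.Base using (_⊎_)
open import Level using (0ℓ)
open import Relation.Binary.Core using (Rel)
open import Relation.Binary.Definitions using (Decidable)
open import Relation.Binary.PropositionalEquality.Core using (_≢_)
open import Relation.Nullary.Negation.Core using (¬_)

-- Decidability of arcs is part of what a finite digraph is: it is what makes
-- the degrees well-defined natural numbers constructively.
record OrientedGraph (n : ℕ) : Set₁ where
  field
    Arc         : Rel (Fin n) 0ℓ
    arc?        : Decidable Arc
    noLoop      : ∀ u → ¬ Arc u u
    noSymmetric : ∀ u v → ¬ (Arc u v × Arc v u)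

module _ {n : ℕ} (D : OrientedGraph n) where
  open OrientedGraph D

  -- u (0-0) v
  NoArcBetween : Rel (Fin n) 0ℓ
  NoArcBetween u v = ¬ Arc u v × ¬ Arc v u

  outdegree : Fin n → ℕ
  outdegree v = length (filter (λ w → arc? v w) (allFin n))

  indegree : Fin n → ℕ
  indegree v = length (filter (λ w → arc? w v) (allFin n))

  -- Integer-valued, so that neither subtraction is truncated.
  score : Fin n → ℤ
  score v = + n - + 1 + + outdegree v - + indegree v

  HasMaximumScore : Fin n → Set
  HasMaximumScore u = ∀ v → score v ≤ score u

  -- The intermediate vertex w is not required to differ from u and v: the
  -- extra instances w = u and w = v either need a loop or give Arc u v again.
  WeaklyReachable≤2 : Rel (Fin n) 0ℓ
  WeaklyReachable≤2 u v =
      Arc u v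
    ⊎ NoArcBetween u v
    ⊎ (∃[ w ] ( (Arc u w × Arc w v)
              ⊎ (Arc u w × NoArcBetween w v)
              ⊎ (NoArcBetween u w × Arc w v)))

  WeakKing : Fin n → Set
  WeakKing u = ∀ v → v ≢ u → WeaklyReachable≤2 u v

{-# OPTIONS --safe #-}
-- If v is not weakly reachable from u within two steps, then v covers u: there
-- is an arc from v to u, every out-neighbour of u is one of v, and every
-- in-neighbour of v is one of u. Since u itself is an out-neighbour of v but not
-- of u, the score of a covering vertex is strictly larger, so a vertex of maximum
-- score is not covered.
module Submission where

open import Defs
open import Data.Nat.Base using (ℕ; _≤_; _<_)
open import Data.Fin.Base using (Fin)

open import Data.Fin.Properties using (any?)
open import Data.Integer.Base as ℤ using (+_)
import Data.Integer.Properties as ℤ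
open import Data.List.Base using (List; length; filter; allFin)
open import Data.List.Membership.Propositional using (_∈_; _∉_)
open import Data.List.Membership.Propositional.Properties using (∈-allFin; ∈-filter⁺; ∈-filter⁻)
open import Data.List.Relation.Binary.Pointwise using (Pointwise-≡⇒≡)
open import Data.List.Relation.Binary.Sublist.Heterogeneous.Properties using (toPointwise)
open import Data.List.Relation.Binary.Sublist.Propositional using (_⊆_; ⊆-refl)
open import Data.List.Relation.Binary.Sublist.Propositional.Properties using (filter⁺; length-mono-≤)
open import Data.Nat.Properties using (≤∧≢⇒<)
open import Data.Product.Base using (_,_; proj₂)
open import Data.Sum.Base using (inj₁; inj₂)
open import Function.Base using (_∘_; flip)
open import Level using (Level)
open import Relation.Binary.Definitions using (Decidable)
open import Relation.Binary.PropositionalEquality using (refl; sym; subst)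
open import Relation.Nullary using (¬_; ¬?; _×-dec_; _⊎-dec_; decidable-stable)
import Relation.Unary as U

private
  variable
    a p q : Level
    A : Set a

length-mono-< : ∀ {xs ys : List A} {x} → xs ⊆ ys → x ∈ ys → x ∉ xs → length xs < length ys
length-mono-< {x = x} xs⊆ys x∈ys x∉xs = ≤∧≢⇒< (length-mono-≤ xs⊆ys) λ |xs|≡|ys| →
  let xs≡ys = Pointwise-≡⇒≡ (toPointwise |xs|≡|ys| xs⊆ys)
  in x∉xs (subst (x ∈_) (sym xs≡ys) x∈ys)

module _ {P : U.Pred A p} {Q : U.Pred A q} (P? : U.Decidable P) (Q? : U.Decidable Q)
         (P⊆Q : P U.⊆ Q) where

  filter-mono-⊆ : ∀ xs → filter P? xs ⊆ filter Q? xs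
  filter-mono-⊆ xs = filter⁺ P? Q? (λ { refl → P⊆Q }) (⊆-refl {x = xs})

  length-filter-mono-≤ : ∀ xs → length (filter P? xs) ≤ length (filter Q? xs)
  length-filter-mono-≤ xs = length-mono-≤ (filter-mono-⊆ xs)

  length-filter-mono-< : ∀ {xs x} → x ∈ xs → Q x → ¬ P x →
                         length (filter P? xs) < length (filter Q? xs)
  length-filter-mono-< {xs} x∈xs Qx ¬Px =
    length-mono-< (filter-mono-⊆ xs) (∈-filter⁺ Q? x∈xs Qx)
                  (¬Px ∘ proj₂ ∘ ∈-filter⁻ P? {xs = xs})

module _ {n : ℕ} (D : OrientedGraph n) where
  open OrientedGraph D

  record Covers (v u : Fin n) : Set where
    field
      arc     : Arc v u
      out⊆out : Arc u U.⊆ Arc v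
      in⊆in   : flip Arc v U.⊆ flip Arc u

  outdegree-mono-< : ∀ {u v w} → Arc u U.⊆ Arc v → Arc v w → ¬ Arc u w →
                     outdegree D u < outdegree D v
  outdegree-mono-< {u} {v} {w} out⊆out =
    length-filter-mono-< (arc? u) (arc? v) out⊆out (∈-allFin w)

  indegree-mono-≤ : ∀ {u v} → flip Arc u U.⊆ flip Arc v → indegree D u ≤ indegree D v
  indegree-mono-≤ {u} {v} in⊆in =
    length-filter-mono-≤ (flip arc? u) (flip arc? v) in⊆in (allFin n)

  score-mono-< : ∀ {u v} → outdegree D u < outdegree D v → indegree D v ≤ indegree D u →
                 score D u ℤ.< score D v
  score-mono-< out< in≤ =
    ℤ.+-mono-<-≤ (ℤ.+-monoʳ-< (+ n ℤ.- + 1) (ℤ.+<+ out<)) (ℤ.neg-mono-≤ (ℤ.+≤+ in≤))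

  covers⇒score-< : ∀ {u v} → Covers v u → score D u ℤ.< score D v
  covers⇒score-< {u} v-covers-u =
    score-mono-< (outdegree-mono-< out⊆out arc (noLoop u)) (indegree-mono-≤ in⊆in)
    where open Covers v-covers-u

  noArcBetween? : Decidable (NoArcBetween D)
  noArcBetween? u v = ¬? (arc? u v) ×-dec ¬? (arc? v u)

  weaklyReachable≤2? : Decidable (WeaklyReachable≤2 D)
  weaklyReachable≤2? u v =
    arc? u v ⊎-dec noArcBetween? u v ⊎-dec any? λ w →
      (arc? u w ×-dec arc? w v)
      ⊎-dec (arc? u w ×-dec noArcBetween? w v)
      ⊎-dec (noArcBetween? u w ×-dec arc? w v)

  reverseArc : ∀ {u v} → ¬ Arc u v → ¬ NoArcBetween D u v → Arc v u
  reverseArc {u} {v} ¬uv ¬u∥v = decidable-stable (arc? v u) λ ¬vu → ¬u∥v (¬uv , ¬vu)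

  ¬weaklyReachable≤2⇒covers : ∀ {u v} → ¬ WeaklyReachable≤2 D u v → Covers v u
  ¬weaklyReachable≤2⇒covers {u} {v} ¬reach = record
    { arc     = reverseArc (¬reach ∘ inj₁) (¬reach ∘ inj₂ ∘ inj₁)
    ; out⊆out = λ uw → reverseArc (¬arc-arc uw) (¬arc-noArc uw)
    ; in⊆in   = λ wv → reverseArc (flip ¬arc-arc wv) (flip ¬noArc-arc wv)
    }
    where
    ¬arc-arc : ∀ {w} → Arc u w → ¬ Arc w v
    ¬arc-arc uw wv = ¬reach (inj₂ (inj₂ (_ , inj₁ (uw , wv))))

    ¬arc-noArc : ∀ {w} → Arc u w → ¬ NoArcBetween D w v
    ¬arc-noArc uw w∥v = ¬reach (inj₂ (inj₂ (_ , inj₂ (inj₁ (uw , w∥v)))))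

    ¬noArc-arc : ∀ {w} → NoArcBetween D u w → ¬ Arc w v
    ¬noArc-arc u∥w wv = ¬reach (inj₂ (inj₂ (_ , inj₂ (inj₂ (u∥w , wv)))))

theorem5 : ∀ (n : ℕ) (D : OrientedGraph n) (u : Fin n) → HasMaximumScore D u → WeakKing D u
theorem5 n D u max v _ = decidable-stable (weaklyReachable≤2? D u v) λ ¬reach →
  ℤ.<⇒≱ (covers⇒score-< D (¬weaklyReachable≤2⇒covers D ¬reach)) (max v)
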